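{- For all integers $k\ge 1$ and $\Delta$ there is a constant $C=C(k,\Delta)$ such that if $H$ is any acyclic digraph with $n$ vertices and maximum degree $\Delta$, then $$\overrightarrow{r_k}(H)\le 2^{\,C(\log n)^{2^{2k-1}}}.$$
   Context: All digraphs are finite, simple and oriented (no loops, parallel or anti-parallel edges). The maximum degree of $H$ is $\max_{v}(|N^+(v)|+|N^-(v)|)$. A copy of $H$ in $T$ is given by an injective map $V(H)\to V(T)$ sending edges of $H$ to edges of $T$ with orientations preserved. For an acyclic digraph $H$ and $k\ge1$, $\overrightarrow{r_k}(H)$ is the least $N$ such that every tournament on $N$ vertices whose edges are colored with $k$ colors contains a monochromatic copy of $H$. All logarithms are to base $2$. -}

module Defs where

open import Data.Bool.Base using (Bool; T)
open import Data.Fin.Base using (Fin)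
open import Data.Fin.Subset using (Subset; ∣_∣)
open import Data.Nat.Base using (ℕ; _+_; _*_; _^_; _⊔_; _≤_; NonZero)
open import Data.Product.Base using (Σ-syntax; ∃-syntax; _×_)
open import Data.Sum.Base using (_⊎_)
open import Data.Vec.Base using (tabulate)
open import Data.Vec.Functional using (foldr)
open import Function.Definitions using (Injective)
open import Relation.Binary.Construct.Closure.Transitive using (TransClosure)
open import Relation.Binary.PropositionalEquality.Core using (_≡_; _≢_)
open import Relation.Nullary.Negation.Core using (¬_)

-- Asymmetry excludes anti-parallel edges and, taking u = v, loops.
record Digraph (n : ℕ) : Set where
  field
    adj : Fin n → Fin n → Bool

  _⟶_ : Fin n → Fin n → Set
  u ⟶ v = T (adj u v)

  field
    asym : ∀ u v → u ⟶ v → ¬ (v ⟶ u)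

  N⁺ N⁻ : Fin n → Subset n
  N⁺ v = tabulate (λ u → adj v u)
  N⁻ v = tabulate (λ u → adj u v)

  degree : Fin n → ℕ
  degree v = ∣ N⁺ v ∣ + ∣ N⁻ v ∣

  maxDegree : ℕ
  maxDegree = foldr _⊔_ 0 degree

  Acyclic : Set
  Acyclic = ∀ v → ¬ TransClosure _⟶_ v v

record Tournament (N : ℕ) : Set where
  field
    digraph : Digraph N

  open Digraph digraph public

  field
    total : ∀ u v → u ≢ v → (u ⟶ v) ⊎ (v ⟶ u)

EdgeColouring : ∀ {N} → ℕ → Tournament N → Set
EdgeColouring k T = ∀ u v → u ⟶ v → Fin k
  where open Tournament T

MonochromaticCopy : ∀ {n N k} → Digraph n → (T : Tournament N) → EdgeColouring k T → Set
MonochromaticCopy {n} {N} {k} H T c =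
  ∃[ i ] Σ[ f ∈ (Fin n → Fin N) ] Injective _≡_ _≡_ f ×
    (∀ u v → u H.⟶ v → Σ[ e ∈ (f u T.⟶ f v) ] c (f u) (f v) e ≡ i)
  where
  module H = Digraph H
  module T = Tournament T

Unavoidable : ∀ {n} → ℕ → Digraph n → ℕ → Set
Unavoidable k H N =
  (T : Tournament N) (c : EdgeColouring k T) → MonochromaticCopy H T c

IsRamseyNumber : ∀ {n} → ℕ → Digraph n → ℕ → Set
IsRamseyNumber k H r = Unavoidable k H r × (∀ N → Unavoidable k H N → r ≤ N)

-- log₂ n ≤ a / b, for b nonzero.  For n = 0 this always holds.
log₂_≤_÷_ : ℕ → ℕ → ℕ → Set
log₂ n ≤ a ÷ b = n ^ b ≤ 2 ^ a

-- N ≤ 2 ^ (C (log₂ n) ^ m), with the real number log₂ n given by its upper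
-- cut: log₂ N ≤ C x ^ m for every rational x = a / b with log₂ n ≤ x.  Since
-- x ↦ C x ^ m is continuous and monotone on x ≥ 0, this is exactly the real
-- inequality when n ≥ 1, not just up to a constant.  For n = 0 it reads log₂ 0
-- as 0, as only x ≥ 0 are considered.
_≤2^[_*⟨log₂_⟩^_] : ℕ → ℕ → ℕ → ℕ → Set
N ≤2^[ C *⟨log₂ n ⟩^ m ] =
  ∀ a b → NonZero b → log₂ n ≤ a ÷ b → log₂ N ≤ (C * a ^ m) ÷ (b ^ m)

{-# OPTIONS --safe #-}

-- Order the vertices of the tournament arbitrarily.  Each pair x < y then carries one of 2k directed
-- colours: the colour of its edge together with the direction of that edge.  Listing H in topological
-- order, a forward colour-i copy of H is an ordered copy of the resulting ordered graph; for backward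
-- edges use a topological order of the reversed digraph.
--
-- One directed colour is removed at a time.  Among 2 ^ O(ℓ²) vertices, a relation R contains an ordered
-- copy of a given bounded-degree ordered graph or there are 2 ^ ℓ vertices spanning no R-edge: cut the
-- vertices into n consecutive blocks and embed greedily, the j-th vertex into the j-th block.  If this
-- gets stuck, there are a large set A before a large set B such that every vertex of A has at most
-- |B| / 2 ^ ℓ R-neighbours in B.  Find an R-free set I in A recursively, delete its neighbours from B,
-- which leaves at least half of B, and find an R-free set J in the rest; then I ∪ J is R-free.
--
-- After 2k - 1 removals only one directed colour is left, so any n surviving vertices contain the
-- copy.  Each removal squares the logarithm of the number of vertices, whence the exponent 2 ^ (2k - 1).

module Submission where

open import Defs
open import Data.Bool.Base using (Bool; true; false; T; if_then_else_)
open import Data.Bool.Properties using (T?; T-irrelevant)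
open import Data.Fin.Base as Fin using (Fin; zero; suc; punchIn; combine; remQuot; finToFun; funToFin)
open import Data.Fin.Permutation as Perm using (Permutation; _⟨$⟩ʳ_; _⟨$⟩ˡ_; inverseʳ)
open import Data.Fin.Properties
  using (_≟_; <-cmp; <⇒≢; all?; any?; pigeonhole; remQuot-combine; finToFun-funToFin; toℕ-inject≤)
open import Data.Fin.Subset using (∣_∣)
open import Data.List.Base using (List; []; _∷_; _++_; length; filter; take; drop; lookup; allFin)
open import Data.List.Membership.Propositional using (_∈_)
open import Data.List.Membership.Propositional.Properties using (∈-++⁻; ∈-filter⁻; ∈-lookup)
open import Data.List.Properties using (length-++; length-take; length-drop; length-tabulate)
open import Data.List.Relation.Binary.Sublist.Propositional as Sub using (_⊆_; ⊆-refl; ⊆-trans)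
open import Data.List.Relation.Binary.Sublist.Propositional.Properties
  using (All-resp-⊆; take-⊆; drop-⊆; filter-⊆; filter⁺; length-mono-≤)
open import Data.List.Relation.Unary.All as All using (All; []; _∷_)
open import Data.List.Relation.Unary.All.Properties using (all-filter)
open import Data.List.Relation.Unary.AllPairs using (AllPairs; []; _∷_)
import Data.List.Relation.Unary.AllPairs.Properties as AllPairs
open import Data.List.Relation.Unary.Any using (here; there)
open import Data.Nat.Base
open import Data.Nat.Induction using (<-rec)
open import Data.Nat.Properties hiding (_≟_; <-cmp; <⇒≢)
open import Data.Nat.Tactic.RingSolver using (solve-∀)
open import Data.Product.Base using (∃-syntax; Σ-syntax; _×_; _,_; proj₁; proj₂; uncurry)
open import Data.Sum.Base as Sum using (_⊎_; inj₁; inj₂)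
open import Data.Vec.Base using (tabulate)
open import Data.Vec.Functional using (foldr)
open import Function.Base using (_∘_; id; flip)
open import Function.Definitions using (Injective)
open import Level using (0ℓ)
open import Relation.Binary.Core using (Rel)
open import Relation.Binary.Construct.Closure.Transitive as TC using (TransClosure; [_]; _∷_)
open import Relation.Binary.Definitions using (tri<; tri≈; tri>) renaming (Decidable to Decidable₂)
open import Relation.Binary.PropositionalEquality
open import Relation.Nullary using (¬_; Dec; yes; no; does; ¬?; contradiction)
open import Relation.Nullary.Decidable using (_×-dec_; _⊎-dec_; _→-dec_; map′)
open import Relation.Unary using (Pred; Decidable)
open import Algebra.Properties.CommutativeMonoid.Sum +-0-commutativeMonoid using (sum; sum-permute)

-- Sublists, counting and a selection principle.

module _ {V : Set} where

  AllPairs-resp-⊆ : {_≺_ : Rel V 0ℓ} {xs ys : List V} → xs ⊆ ys → AllPairs _≺_ ys → AllPairs _≺_ xs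
  AllPairs-resp-⊆ Sub.[]             []       = []
  AllPairs-resp-⊆ (_ Sub.∷ʳ τ)       (_ ∷ ps) = AllPairs-resp-⊆ τ ps
  AllPairs-resp-⊆ (refl Sub.∷ τ)     (p ∷ ps) = All-resp-⊆ τ p ∷ AllPairs-resp-⊆ τ ps

  length-filter-split : {P : Pred V 0ℓ} (P? : Decidable P) (xs : List V) →
    length (filter P? xs) + length (filter (¬? ∘ P?) xs) ≡ length xs
  length-filter-split P? [] = refl
  length-filter-split P? (x ∷ xs) with does (P? x)
  ... | true  = cong suc (length-filter-split P? xs)
  ... | false = trans (+-suc _ _) (cong suc (length-filter-split P? xs))

-- Going through `tabulate` makes this agree by definition with both summands of `degree`.
∥_∥ : ∀ {n} → (Fin n → Bool) → ℕ
∥ e ∥ = ∣ tabulate e ∣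

∥∥-suc : ∀ {n} (e : Fin (suc n) → Bool) → ∥ e ∘ suc ∥ ≤ ∥ e ∥
∥∥-suc e with e zero
... | true  = n≤1+n _
... | false = ≤-refl

-- The conditions with `T (e j)` are imposed one after another. If `F` of the remaining elements
-- violate one of them, the first alternative holds; otherwise fewer than `F` are discarded, so all
-- conditions together cannot exhaust a list longer than `∥ e ∥ * F`.
select : ∀ {V : Set} F {n} (e : Fin n → Bool) (P : Fin n → Pred V 0ℓ) (P? : ∀ j → Decidable (P j))
  (xs : List V) → ∥ e ∥ * F < length xs →
  (∃[ j ] Σ[ ys ∈ List V ] T (e j) × ys ⊆ xs × F ≤ length ys × All (¬_ ∘ P j) ys) ⊎
  (∃[ x ] x ∈ xs × (∀ j → T (e j) → P j x))
select F {zero}  e P P? (x ∷ xs) _ = inj₂ (x , here refl , λ ())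
select F {suc n} e P P? xs big with e zero in eq
... | false with select F (e ∘ suc) (P ∘ suc) (P? ∘ suc) xs big
...   | inj₁ (j , r)       = inj₁ (suc j , r)
...   | inj₂ (x , x∈ , Px) = inj₂ (x , x∈ , λ where
          zero    t → contradiction (subst T eq t) λ ()
          (suc j) t → Px j t)
select F {suc n} e P P? xs big | true with F ≤? length (filter (¬? ∘ P? zero) xs)
... | yes F≤ = inj₁ (zero , _ , subst T (sym eq) _ , filter-⊆ (¬? ∘ P? zero) xs , F≤ ,
                     all-filter (¬? ∘ P? zero) xs)
... | no F≰ with select F (e ∘ suc) (P ∘ suc) (P? ∘ suc) (filter (P? zero) xs) rest-big
  where
  rest-big : ∥ e ∘ suc ∥ * F < length (filter (P? zero) xs)
  rest-big = +-cancelʳ-< F _ _ (begin-strict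
    ∥ e ∘ suc ∥ * F + F  ≡⟨ +-comm (∥ e ∘ suc ∥ * F) F ⟩
    F + ∥ e ∘ suc ∥ * F  <⟨ big ⟩
    length xs            ≡⟨ length-filter-split (P? zero) xs ⟨
    length (filter (P? zero) xs) + length (filter (¬? ∘ P? zero) xs)
                         ≤⟨ +-monoʳ-≤ (length (filter (P? zero) xs)) (<⇒≤ (≰⇒> F≰)) ⟩
    length (filter (P? zero) xs) + F  ∎)
    where open ≤-Reasoning
...   | inj₁ (j , ys , t , ys⊆ , r) = inj₁ (suc j , ys , t , ⊆-trans ys⊆ (filter-⊆ (P? zero) xs) , r)
...   | inj₂ (x , x∈ , Px) = inj₂ (x , proj₁ (∈-filter⁻ (P? zero) x∈) , λ where
          zero    _ → proj₂ (∈-filter⁻ (P? zero) {xs = xs} x∈)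
          (suc j) t → Px j t)

-- Greedy embedding and sparse pairs.

module Greedy {V : Set} {R : Rel V 0ℓ} (R? : Decidable₂ R) where

  deg : V → List V → ℕ
  deg x ys = length (filter (R? x) ys)

  -- Density at most 1 / `M` from every single vertex, with the denominator cleared.
  Sparse : ℕ → List V → List V → Set
  Sparse M xs ys = All (λ x → deg x ys * M ≤ length ys) xs

  restrict : Bool → V → List V → List V
  restrict true  x ys = filter (R? x) ys
  restrict false x ys = ys

  restrict-⊆ : ∀ b x ys → restrict b x ys ⊆ ys
  restrict-⊆ true  x ys = filter-⊆ (R? x) ys
  restrict-⊆ false x ys = ⊆-refl

  ∈-restrict⇒R : ∀ b x ys {y} → y ∈ restrict b x ys → T b → R x y
  ∈-restrict⇒R true x ys y∈ _ = proj₂ (∈-filter⁻ (R? x) {xs = ys} y∈)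

  -- The candidate list of j keeps length at least q M ^ d, where d counts the neighbours of j
  -- still to be embedded before it.
  greedy : ∀ F q M .{{_ : NonZero M}} Δ {n} (E : Fin n → Fin n → Bool) (C : Fin n → List V) →
    Δ * F < q → F + F ≤ q →
    (∀ i → ∥ E i ∥ ≤ Δ) →
    (∀ j → q * M ^ ∥ (λ i → E i j) ∥ ≤ length (C j)) →
    (Σ[ y ∈ (Fin n → V) ] (∀ j → y j ∈ C j) × (∀ i j → i Fin.< j → T (E i j) → R (y i) (y j))) ⊎
    (∃[ i ] ∃[ j ] Σ[ A ∈ List V ] Σ[ B ∈ List V ] i Fin.< j × A ⊆ C i × B ⊆ C j ×
      F ≤ length A × F + F ≤ length B × Sparse M A B)
  greedy F q M Δ {zero} E C _ _ _ _ = inj₁ ((λ ()) , (λ ()) , λ ())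
  greedy F q M Δ {suc n} E C ΔF<q 2F≤q out-deg large
    -- The image of vertex `zero` has to keep more than a 1 / `M` share, or at least that share, of
    -- the candidates of each of its later neighbours.
    with select F (E zero ∘ suc) (λ j x → length (C (suc j)) ≤ deg x (C (suc j)) * M)
           (λ j x → length (C (suc j)) ≤? deg x (C (suc j)) * M) (C zero) room
    where
    q≤ : ∀ j → q ≤ length (C j)
    q≤ j = ≤-trans (m≤m*n q (M ^ ∥ (λ i → E i j) ∥) {{m^n≢0 M ∥ (λ i → E i j) ∥}}) (large j)
    room : ∥ E zero ∘ suc ∥ * F < length (C zero)
    room = ≤-<-trans (*-monoˡ-≤ F (≤-trans (∥∥-suc (E zero)) (out-deg zero))) (<-≤-trans ΔF<q (q≤ zero))
  -- The embedding is stuck: `F` candidates fail at the same `j`. The whole list `C (suc j)` serves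
  -- as `B`; its size `F + F` allows for a later halving.
  ... | inj₁ (j , A , _ , A⊆ , F≤A , sparse) =
        inj₂ (zero , suc j , A , C (suc j) , z<s , A⊆ , ⊆-refl , F≤A , ≤-trans 2F≤q
                (≤-trans (m≤m*n q (M ^ ∥ (λ i → E i (suc j)) ∥) {{m^n≢0 M ∥ (λ i → E i (suc j)) ∥}}) (large (suc j)))
              , All.map (<⇒≤ ∘ ≰⇒>) sparse)
  ... | inj₂ (x , x∈ , good) with greedy F q M Δ (λ i j → E (suc i) (suc j)) C′ ΔF<q 2F≤q
                                  (λ i → ≤-trans (∥∥-suc (E (suc i))) (out-deg (suc i))) large′
    where
    C′ : Fin n → List V
    C′ j = restrict (E zero (suc j)) x (C (suc j))
    large′ : ∀ j → q * M ^ ∥ (λ i → E (suc i) (suc j)) ∥ ≤ length (C′ j)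
    large′ j with E zero (suc j) | good j | large (suc j)
    ... | false | _  | l = l
    -- An embedded neighbour leaves the exponent, and the factor `M` thus freed pays for the
    -- shrinking.
    ... | true  | gd | l = *-cancelʳ-≤ _ _ M (begin
      q * M ^ d * M     ≡⟨ *-assoc q (M ^ d) M ⟩
      q * (M ^ d * M)   ≡⟨ cong (q *_) (*-comm (M ^ d) M) ⟩
      q * M ^ suc d     ≤⟨ l ⟩
      length (C (suc j)) ≤⟨ gd _ ⟩
      deg x (C (suc j)) * M ∎)
      where
      open ≤-Reasoning
      d = ∥ (λ i → E (suc i) (suc j)) ∥
  ...   | inj₂ (i , j , A , B , i<j , A⊆ , B⊆ , r) =
          inj₂ (suc i , suc j , A , B , s<s i<j , ⊆-trans A⊆ (restrict-⊆ (E zero (suc i)) x _) ,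
                ⊆-trans B⊆ (restrict-⊆ (E zero (suc j)) x _) , r)
  ...   | inj₁ (y , y∈ , edges) = inj₁ (y′ , y′∈ , edges′)
    where
    y′ : Fin (suc n) → V
    y′ zero    = x
    y′ (suc j) = y j
    y′∈ : ∀ j → y′ j ∈ C j
    y′∈ zero    = x∈
    y′∈ (suc j) = Sub.lookup (restrict-⊆ (E zero (suc j)) x _) (y∈ j)
    edges′ : ∀ i j → i Fin.< j → T (E i j) → R (y′ i) (y′ j)
    edges′ zero    (suc j) _   t = ∈-restrict⇒R (E zero (suc j)) x _ (y∈ j) t
    edges′ (suc i) (suc j) i<j t = edges i j (s<s⁻¹ i<j) t

  -- Each vertex of `xs` deletes at most a 1 / `M` share of `ys`. Multiplying by `M` and adding the
  -- loss on the right avoids division and truncated subtraction.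
  remove-neighbours : ∀ M xs ys → Sparse M xs ys →
    Σ[ zs ∈ List V ] zs ⊆ ys × (∀ {x z} → x ∈ xs → z ∈ zs → ¬ R x z) ×
      length ys * M ≤ length zs * M + length xs * length ys
  remove-neighbours M [] ys [] = ys , ⊆-refl , (λ ()) , ≤-reflexive (sym (+-identityʳ _))
  remove-neighbours M (x ∷ xs) ys (d ∷ ds) with zs , zs⊆ , indep , bound ← remove-neighbours M xs ys ds =
    ws , ⊆-trans (filter-⊆ (¬? ∘ R? x) zs) zs⊆ , indep′ , bound′
    where
    ws = filter (¬? ∘ R? x) zs
    indep′ : ∀ {x′ z} → x′ ∈ x ∷ xs → z ∈ ws → ¬ R x′ z
    indep′ (here refl) z∈ = proj₂ (∈-filter⁻ (¬? ∘ R? x) {xs = zs} z∈)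
    indep′ (there x∈)  z∈ = indep x∈ (proj₁ (∈-filter⁻ (¬? ∘ R? x) {xs = zs} z∈))
    open ≤-Reasoning
    bound′ : length ys * M ≤ length ws * M + (length ys + length xs * length ys)
    bound′ = begin
      length ys * M                                          ≤⟨ bound ⟩
      length zs * M + length xs * length ys                  ≡⟨ cong (λ l → l * M + _) (length-filter-split (R? x) zs) ⟨
      (deg x zs + length ws) * M + length xs * length ys     ≡⟨ rearrange (deg x zs) (length ws) M _ ⟩
      length ws * M + (deg x zs * M + length xs * length ys)
        -- Sparseness is known for `ys`, and degrees into its sublist `zs` are no larger.
        ≤⟨ +-monoʳ-≤ (length ws * M) (+-monoˡ-≤ _ (≤-trans (*-monoˡ-≤ M
             (length-mono-≤ (filter⁺ (R? x) (R? x) (λ { refl → id }) zs⊆))) d)) ⟩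
      length ws * M + (length ys + length xs * length ys)    ∎
      where
      rearrange : ∀ a b m c → (a + b) * m + c ≡ b * m + (a * m + c)
      rearrange = solve-∀

-- Consecutive blocks and the removal of one relation.

take-drop-related : ∀ {V : Set} {_≺_ : Rel V 0ℓ} s {xs : List V} → AllPairs _≺_ xs →
  ∀ {x y} → x ∈ take s xs → y ∈ drop s xs → x ≺ y
take-drop-related (suc s) (p ∷ ps) (here refl) y∈ = All.lookup p (Sub.lookup (drop-⊆ s _) y∈)
take-drop-related (suc s) (p ∷ ps) (there x∈)  y∈ = take-drop-related s ps x∈ y∈

blocks : ∀ {V : Set} {_≺_ : Rel V 0ℓ} n s (xs : List V) → AllPairs _≺_ xs → n * s ≤ length xs →
  Σ[ C ∈ (Fin n → List V) ] (∀ j → s ≤ length (C j)) × (∀ j → C j ⊆ xs) ×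
    (∀ {i j x y} → i Fin.< j → x ∈ C i → y ∈ C j → x ≺ y)
blocks zero s xs _ _ = (λ ()) , (λ ()) , (λ ()) , λ { {()} }
blocks {V} {_≺_} (suc n) s xs ps big
  with C , large , C⊆ , C≺ ← blocks n s (drop s xs) (AllPairs.drop⁺ s ps)
         (subst (n * s ≤_) (sym (length-drop s xs))
           (m+n≤o⇒m≤o∸n (n * s) (≤-trans (≤-reflexive (+-comm (n * s) s)) big)))
  = C′ , large′ , C′⊆ , C′≺
  where
  C′ : Fin (suc n) → List V
  C′ zero    = take s xs
  C′ (suc j) = C j
  large′ : ∀ j → s ≤ length (C′ j)
  large′ zero    = ≤-reflexive (sym (trans (length-take s xs) (m≤n⇒m⊓n≡m (m+n≤o⇒m≤o s big))))
  large′ (suc j) = large j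
  C′⊆ : ∀ j → C′ j ⊆ xs
  C′⊆ zero    = take-⊆ s xs
  C′⊆ (suc j) = ⊆-trans (C⊆ j) (drop-⊆ s xs)
  C′≺ : ∀ {i j x y} → i Fin.< j → x ∈ C′ i → y ∈ C′ j → x ≺ y
  C′≺ {zero}  {suc j} _   x∈ y∈ = take-drop-related s ps x∈ (Sub.lookup (C⊆ j) y∈)
  C′≺ {suc i} {suc j} i<j x∈ y∈ = C≺ (s<s⁻¹ i<j) x∈ y∈

-- Nonadjacent pairs must respect `_≺_` too, which is what makes the final copy injective.
OrderedCopy : ∀ {V : Set} {n} → Rel V 0ℓ → Rel V 0ℓ → (Fin n → Fin n → Bool) → Set
OrderedCopy {V} {n} _≺_ R E =
  Σ[ y ∈ (Fin n → V) ] (∀ i j → i Fin.< j → y i ≺ y j × (T (E i j) → R (y i) (y j)))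

1+m≤2^m : ∀ m → 1 + m ≤ 2 ^ m
1+m≤2^m zero    = ≤-refl
1+m≤2^m (suc m) = begin
  suc (suc m)     ≤⟨ s≤s (1+m≤2^m m) ⟩
  1 + 2 ^ m       ≤⟨ +-monoˡ-≤ (2 ^ m) (m^n>0 2 m) ⟩
  2 ^ m + 2 ^ m   ≡⟨ cong (2 ^ m +_) (+-identityʳ (2 ^ m)) ⟨
  2 ^ suc m       ∎
  where open ≤-Reasoning

double : ∀ m → m + m ≡ 2 * m
double = solve-∀

-- The loss is `i * b / m`, at most half of `b` by `2 * i ≤ m`. Doubling the bound and cancelling
-- `b * m` proves this without division.
half-remains : ∀ b b′ i m .{{_ : NonZero m}} → 2 * i ≤ m → b * m ≤ b′ * m + i * b → b ≤ 2 * b′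
half-remains b b′ i m 2i≤m bound = *-cancelʳ-≤ b (2 * b′) m (+-cancelʳ-≤ (b * m) _ _ (begin
  b * m + b * m                          ≤⟨ +-mono-≤ bound bound ⟩
  (b′ * m + i * b) + (b′ * m + i * b)    ≡⟨ rearrange b b′ i m ⟩
  2 * b′ * m + 2 * i * b                 ≤⟨ +-monoʳ-≤ (2 * b′ * m) (*-monoˡ-≤ b 2i≤m) ⟩
  2 * b′ * m + m * b                     ≡⟨ cong (2 * b′ * m +_) (*-comm m b) ⟩
  2 * b′ * m + b * m                     ∎))
  where
  open ≤-Reasoning
  rearrange : ∀ b b′ i m → (b′ * m + i * b) + (b′ * m + i * b) ≡ 2 * b′ * m + 2 * i * b
  rearrange = solve-∀

module Avoid {V : Set} {R : Rel V 0ℓ} (R? : Decidable₂ R) (_≺_ : Rel V 0ℓ)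
  {n} (E : Fin n → Fin n → Bool) (p Δ ℓ : ℕ) (n≤2^p : n ≤ 2 ^ p)
  (out-deg : ∀ i → ∥ E i ∥ ≤ Δ) (in-deg : ∀ j → ∥ (λ i → E i j) ∥ ≤ Δ) where

  open Greedy R?

  _≺∖R_ : Rel V 0ℓ
  x ≺∖R y = x ≺ y × ¬ R x y

  -- The bits paid for one doubling of the independent set: `p` for cutting into `n` blocks, `suc Δ`
  -- for passing from `F` to `q`, and `ℓ * Δ` for shrinking a block up to `Δ` times by the factor
  -- `2 ^ ℓ`.
  exponent : ℕ
  exponent = p + suc Δ + ℓ * Δ

  module _ (h : ℕ) where

    -- `F` is the input size at level `h` of the recursion. The factor `2 ^ suc Δ` in `q` exceeds
    -- `Δ`, for the selection, and is at least 2, for the halving of `B`.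
    F q blockSize : ℕ
    F = 2 ^ (h * exponent)
    q = 2 ^ suc Δ * F
    blockSize = q * 2 ^ (ℓ * Δ)

    open ≤-Reasoning

    n*blockSize≤ : n * blockSize ≤ 2 ^ (suc h * exponent)
    n*blockSize≤ = begin
      n * (2 ^ suc Δ * F * 2 ^ (ℓ * Δ))      ≤⟨ *-monoˡ-≤ blockSize n≤2^p ⟩
      2 ^ p * (2 ^ suc Δ * F * 2 ^ (ℓ * Δ))  ≡⟨ rearrange (2 ^ p) (2 ^ suc Δ) F (2 ^ (ℓ * Δ)) ⟩
      2 ^ p * 2 ^ suc Δ * 2 ^ (ℓ * Δ) * F    ≡⟨ cong (λ x → x * 2 ^ (ℓ * Δ) * F) (^-distribˡ-+-* 2 p (suc Δ)) ⟨
      2 ^ (p + suc Δ) * 2 ^ (ℓ * Δ) * F      ≡⟨ cong (_* F) (^-distribˡ-+-* 2 (p + suc Δ) (ℓ * Δ)) ⟨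
      2 ^ exponent * F                       ≡⟨ ^-distribˡ-+-* 2 exponent (h * exponent) ⟨
      2 ^ (suc h * exponent)                 ∎
      where
      rearrange : ∀ a b c d → a * (b * c * d) ≡ a * b * d * c
      rearrange = solve-∀

    ΔF<q : Δ * F < q
    ΔF<q = *-monoˡ-< F {{m^n≢0 2 (h * exponent)}} (≤-trans (1+m≤2^m Δ) (^-monoʳ-≤ 2 (n≤1+n Δ)))

    2F≤q : F + F ≤ q
    2F≤q = ≤-trans (≤-reflexive (double F)) (*-monoˡ-≤ F (^-monoʳ-≤ 2 {1} {suc Δ} (s≤s z≤n)))

    candidates≤blockSize : ∀ j → q * (2 ^ ℓ) ^ ∥ (λ i → E i j) ∥ ≤ blockSize
    candidates≤blockSize j = *-monoʳ-≤ q (begin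
      (2 ^ ℓ) ^ ∥ (λ i → E i j) ∥  ≡⟨ ^-*-assoc 2 ℓ ∥ (λ i → E i j) ∥ ⟩
      2 ^ (ℓ * ∥ (λ i → E i j) ∥)  ≤⟨ ^-monoʳ-≤ 2 (*-monoʳ-≤ ℓ (in-deg j)) ⟩
      2 ^ (ℓ * Δ)                  ∎)

  -- Induction on `h`, while `ℓ` and with it the sparsity threshold `2 ^ ℓ` stay fixed. The length
  -- is exact because an upper bound on `length I` limits what is deleted from `B`.
  avoid : ∀ h → h ≤ ℓ → (xs : List V) → AllPairs _≺_ xs → F h ≤ length xs →
    OrderedCopy _≺_ R E ⊎
    (Σ[ I ∈ List V ] (∀ {x} → x ∈ I → x ∈ xs) × AllPairs _≺∖R_ I × length I ≡ 2 ^ h)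
  -- `F 0` is 1, so the list is not empty.
  avoid zero    _   (x ∷ xs) _  _   = inj₂ (x ∷ [] , (λ { (here refl) → here refl }) , [] ∷ [] , refl)
  avoid (suc h) h<ℓ xs       ps big
    with C , large , C⊆ , C≺ ← blocks n (blockSize h) xs ps (≤-trans (n*blockSize≤ h) big)
    with greedy (F h) (q h) (2 ^ ℓ) {{m^n≢0 2 ℓ}} Δ E C (ΔF<q h) (2F≤q h) out-deg
           (λ j → ≤-trans (candidates≤blockSize h j) (large j))
  ... | inj₁ (y , y∈ , edges) = inj₁ (y , λ i j i<j → C≺ i<j (y∈ i) (y∈ j) , edges i j i<j)
  ... | inj₂ (i , j , A , B , i<j , A⊆ , B⊆ , F≤A , 2F≤B , sparse)
    with avoid h (<⇒≤ h<ℓ) A (AllPairs-resp-⊆ (⊆-trans A⊆ (C⊆ i)) ps) F≤A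
  ...   | inj₁ copy = inj₁ copy
  ...   | inj₂ (I , I⊆ , I-indep , ∣I∣)
    with B′ , B′⊆ , I-B′ , bound ← remove-neighbours (2 ^ ℓ) I B (All.tabulate (All.lookup sparse ∘ I⊆))
    with avoid h (<⇒≤ h<ℓ) B′ (AllPairs-resp-⊆ (⊆-trans B′⊆ (⊆-trans B⊆ (C⊆ j))) ps) (F≤B′ bound)
    where
    F≤B′ : length B * 2 ^ ℓ ≤ length B′ * 2 ^ ℓ + length I * length B → F h ≤ length B′
    -- As `h < ℓ`, twice the size of `I` is `2 ^ suc h ≤ 2 ^ ℓ`, so at least half of `B` survives.
    F≤B′ bound = *-cancelˡ-≤ 2 (≤-trans (≤-reflexive (sym (double (F h))))
      (≤-trans 2F≤B (half-remains (length B) (length B′) (length I) (2 ^ ℓ) {{m^n≢0 2 ℓ}} 2I≤M bound)))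
      where
      2I≤M : 2 * length I ≤ 2 ^ ℓ
      2I≤M = subst (λ l → 2 * l ≤ 2 ^ ℓ) (sym ∣I∣) (^-monoʳ-≤ 2 h<ℓ)
  ...   | inj₁ copy = inj₁ copy
  ...   | inj₂ (J , J⊆ , J-indep , ∣J∣) = inj₂ (I ++ J , ⊆xs , indep , size)
    where
    I⊆C : ∀ {x} → x ∈ I → x ∈ C i
    I⊆C x∈ = Sub.lookup A⊆ (I⊆ x∈)
    J⊆C : ∀ {x} → x ∈ J → x ∈ C j
    J⊆C x∈ = Sub.lookup B⊆ (Sub.lookup B′⊆ (J⊆ x∈))
    ⊆xs : ∀ {x} → x ∈ I ++ J → x ∈ xs
    ⊆xs x∈ with ∈-++⁻ I x∈
    ... | inj₁ x∈I = Sub.lookup (C⊆ i) (I⊆C x∈I)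
    ... | inj₂ x∈J = Sub.lookup (C⊆ j) (J⊆C x∈J)
    indep : AllPairs _≺∖R_ (I ++ J)
    indep = AllPairs.++⁺ I-indep J-indep (All.tabulate λ x∈ → All.tabulate λ y∈ →
      C≺ i<j (I⊆C x∈) (J⊆C y∈) , I-B′ x∈ (J⊆ y∈))
    size : length (I ++ J) ≡ 2 ^ suc h
    size = trans (length-++ I) (trans (cong₂ _+_ ∣I∣ ∣J∣) (double (2 ^ h)))

-- Iterating the removal over all relations.

scale : ℕ → ℕ
scale Δ = 2 * suc Δ

-- The base-2 logarithm of a sufficient number of vertices when `suc K` relations are present.
height : ℕ → ℕ → ℕ → ℕ
height Δ p zero    = p
height Δ p (suc K) = scale Δ * (height Δ p K * height Δ p K)

-- After multiplication by `scale Δ` the recursion is plain squaring, so `K` steps give the power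
-- `2 ^ K`.
scale*height : ∀ Δ p K → scale Δ * height Δ p K ≡ (scale Δ * p) ^ (2 ^ K)
scale*height Δ p zero    = sym (*-identityʳ _)
scale*height Δ p (suc K) = begin
  s * (s * (t * t))                          ≡⟨ rearrange s t ⟩
  (s * t) * (s * t)                          ≡⟨ cong₂ _*_ (scale*height Δ p K) (scale*height Δ p K) ⟩
  (s * p) ^ (2 ^ K) * (s * p) ^ (2 ^ K)      ≡⟨ ^-distribˡ-+-* (s * p) (2 ^ K) (2 ^ K) ⟨
  (s * p) ^ (2 ^ K + 2 ^ K)                  ≡⟨ cong ((s * p) ^_) (double (2 ^ K)) ⟩
  (s * p) ^ (2 ^ suc K)                      ∎
  where
  open ≡-Reasoning
  s = scale Δ
  t = height Δ p K
  rearrange : ∀ s t → s * (s * (t * t)) ≡ (s * t) * (s * t)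
  rearrange = solve-∀

m≤m*m : ∀ m → m ≤ m * m
m≤m*m zero    = z≤n
m≤m*m (suc m) = m≤m*n (suc m) (suc m)

p≤height : ∀ Δ p K → p ≤ height Δ p K
p≤height Δ p zero    = ≤-refl
p≤height Δ p (suc K) = ≤-trans (p≤height Δ p K) (≤-trans (m≤m*m _) (m≤n*m _ (scale Δ)))

-- The left side is the logarithm of the input size of `avoid` at `h = ℓ`. For nonzero `ℓ` the three
-- summands are at most `ℓ`, `ℓ * suc Δ` and `ℓ * Δ`, which add up to `scale Δ * ℓ`.
height-step : ∀ Δ p ℓ → p ≤ ℓ → ℓ * (p + suc Δ + ℓ * Δ) ≤ scale Δ * (ℓ * ℓ)
height-step Δ p zero      _   = z≤n
height-step Δ p ℓ@(suc _) p≤ℓ = begin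
  ℓ * (p + suc Δ + ℓ * Δ)        ≤⟨ *-monoʳ-≤ ℓ (+-monoˡ-≤ (ℓ * Δ) (+-mono-≤ p≤ℓ (m≤n*m (suc Δ) ℓ))) ⟩
  ℓ * (ℓ + ℓ * suc Δ + ℓ * Δ)    ≡⟨ rearrange ℓ Δ ⟩
  scale Δ * (ℓ * ℓ)              ∎
  where
  open ≤-Reasoning
  rearrange : ∀ ℓ Δ → ℓ * (ℓ + ℓ * (1 + Δ) + ℓ * Δ) ≡ 2 * (1 + Δ) * (ℓ * ℓ)
  rearrange = solve-∀

AllPairs-lookup : ∀ {V : Set} {_≺_ : Rel V 0ℓ} {xs : List V} → AllPairs _≺_ xs →
  ∀ {i j} → i Fin.< j → lookup xs i ≺ lookup xs j
AllPairs-lookup (p ∷ ps) {zero}  {suc j} _   = All.lookup p (∈-lookup j)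
AllPairs-lookup (p ∷ ps) {suc i} {suc j} i<j = AllPairs-lookup ps (s<s⁻¹ i<j)

-- Induction on the number of relations. `_≺_` is arbitrary because each removal intersects it with
-- the complement of the removed relation; the remaining relations then still cover all its pairs.
ordered-ramsey : ∀ {V : Set} {n} K (R : Fin (suc K) → Rel V 0ℓ) (R? : ∀ d → Decidable₂ (R d))
  (E : Fin (suc K) → Fin n → Fin n → Bool) p Δ → n ≤ 2 ^ p →
  (∀ d i → ∥ E d i ∥ ≤ Δ) → (∀ d j → ∥ (λ i → E d i j) ∥ ≤ Δ) →
  (_≺_ : Rel V 0ℓ) → (∀ {x y} → x ≺ y → ∃[ d ] R d x y) →
  (xs : List V) → AllPairs _≺_ xs → 2 ^ height Δ p K ≤ length xs →
  ∃[ d ] OrderedCopy _≺_ (R d) (E d)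
-- A single relation covers every pair, so the first `n` entries carry any ordered graph.
ordered-ramsey zero R R? E p Δ n≤ out-deg in-deg _≺_ coloured xs ps big =
  zero , (λ i → lookup xs (Fin.inject≤ i n≤∣xs∣)) , λ i j i<j →
    let x≺y = AllPairs-lookup ps (subst₂ _<_ (sym (toℕ-inject≤ i n≤∣xs∣)) (sym (toℕ-inject≤ j n≤∣xs∣)) i<j)
    in x≺y , λ _ → only (coloured x≺y)
  where
  n≤∣xs∣ = ≤-trans n≤ big
  only : ∀ {x y} → ∃[ d ] R d x y → R zero x y
  only (zero , r) = r
ordered-ramsey (suc K) R R? E p Δ n≤ out-deg in-deg _≺_ coloured xs ps big
  -- Running to `h = ℓ` yields `2 ^ ℓ` elements, precisely the size that the recursive call asks
  -- for.
  with Avoid.avoid (R? zero) _≺_ (E zero) p Δ ℓ n≤ (out-deg zero) (in-deg zero) ℓ ≤-refl xs ps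
         (≤-trans (^-monoʳ-≤ 2 (height-step Δ p ℓ (p≤height Δ p K))) big)
  where ℓ = height Δ p K
... | inj₁ copy = zero , copy
... | inj₂ (I , _ , indep , ∣I∣)
  with ordered-ramsey K (R ∘ suc) (R? ∘ suc) (E ∘ suc) p Δ n≤ (out-deg ∘ suc) (in-deg ∘ suc)
         _ other I indep (≤-reflexive (sym ∣I∣))
  where
  other : ∀ {x y} → x ≺ y × ¬ R zero x y → ∃[ d ] R (suc d) x y
  other (x≺y , ¬r) with coloured x≺y
  ... | zero  , r = contradiction r ¬r
  ... | suc d , r = d , r
...   | d , y , edges = suc d , y , λ i j i<j → proj₁ (proj₁ (edges i j i<j)) , proj₂ (edges i j i<j)

-- Degrees and topological orders.

∥∥≡sum : ∀ {n} (e : Fin n → Bool) → ∥ e ∥ ≡ sum (λ i → if e i then 1 else 0)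
∥∥≡sum {zero}  e = refl
∥∥≡sum {suc n} e with e zero
... | true  = cong suc (∥∥≡sum (e ∘ suc))
... | false = ∥∥≡sum (e ∘ suc)

∥∥-permute : ∀ {n} (e : Fin n → Bool) (σ : Permutation n n) → ∥ e ∘ (σ ⟨$⟩ʳ_) ∥ ≡ ∥ e ∥
∥∥-permute e σ = begin
  ∥ e ∘ (σ ⟨$⟩ʳ_) ∥                             ≡⟨ ∥∥≡sum (e ∘ (σ ⟨$⟩ʳ_)) ⟩
  sum (λ i → if e (σ ⟨$⟩ʳ i) then 1 else 0)   ≡⟨ sum-permute (λ i → if e i then 1 else 0) σ ⟨
  sum (λ i → if e i then 1 else 0)            ≡⟨ ∥∥≡sum e ⟨
  ∥ e ∥                                         ∎
  where open ≡-Reasoning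

≤-foldr-⊔ : ∀ {n} (f : Fin n → ℕ) i → f i ≤ foldr _⊔_ 0 f
≤-foldr-⊔ f zero    = m≤m⊔n _ _
≤-foldr-⊔ f (suc i) = ≤-trans (≤-foldr-⊔ (f ∘ suc) i) (m≤n⊔m (f zero) _)

module _ {n} {_⟶_ : Rel (Fin (suc n)) 0ℓ} (_⟶?_ : Decidable₂ _⟶_)
  (acyclic : ∀ v → ¬ TransClosure _⟶_ v v) where

  -- A backward walk through predecessors has `suc (suc n)` positions among `suc n` vertices, and a
  -- repetition closes a directed cycle.
  acyclic⇒¬all-have-predecessors : ¬ (∀ v → ∃[ u ] u ⟶ v)
  acyclic⇒¬all-have-predecessors pred-of =
    let i , j , i<j , eq = pigeonhole (n<1+n (suc n)) (walk ∘ Fin.toℕ)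
    in acyclic _ (subst (λ v → TransClosure _⟶_ v (walk (Fin.toℕ i))) (sym eq) (path i<j))
    where
    walk : ℕ → Fin (suc n)
    walk zero    = zero
    walk (suc i) = proj₁ (pred-of (walk i))
    path : ∀ {i j} → i < j → TransClosure _⟶_ (walk j) (walk i)
    path {i} {suc j} (s≤s i≤j) with m≤n⇒m<n∨m≡n i≤j
    ... | inj₁ i<j  = proj₂ (pred-of (walk j)) ∷ path i<j
    ... | inj₂ refl = [ proj₂ (pred-of (walk j)) ]

  acyclic⇒source : ∃[ v ] (∀ u → ¬ u ⟶ v)
  acyclic⇒source with any? (λ v → all? (λ u → ¬? (u ⟶? v)))
  ... | yes s = s
  ... | no ¬s = contradiction predecessor acyclic⇒¬all-have-predecessors
    where
    predecessor : ∀ v → ∃[ u ] u ⟶ v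
    predecessor v with any? (λ u → u ⟶? v)
    ... | yes r = r
    ... | no ¬r = contradiction (v , λ u u⟶v → ¬r (u , u⟶v)) ¬s

gmap : ∀ {A B : Set} {_⟶_ : Rel B 0ℓ} (f : A → B) {u v} →
  TransClosure (λ a b → f a ⟶ f b) u v → TransClosure _⟶_ (f u) (f v)
gmap f [ e ]   = [ e ]
gmap f (e ∷ p) = e ∷ gmap f p

-- A source comes first; the other vertices, still acyclic, are ordered recursively.
topological-order : ∀ {n} {_⟶_ : Rel (Fin n) 0ℓ} → Decidable₂ _⟶_ → (∀ v → ¬ TransClosure _⟶_ v v) →
  Σ[ σ ∈ Permutation n n ] (∀ i j → (σ ⟨$⟩ʳ i) ⟶ (σ ⟨$⟩ʳ j) → i Fin.< j)
topological-order {zero}  _ _ = Perm.id , λ ()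
topological-order {suc n} {_⟶_} _⟶?_ acyclic
  with s , source ← acyclic⇒source _⟶?_ acyclic
  with σ , ordered ← topological-order (λ u v → punchIn s u ⟶? punchIn s v) (λ v c → acyclic _ (gmap (punchIn s) c))
  = Perm.insert zero s σ , ordered′
  where
  at-suc : ∀ i → Perm.insert zero s σ ⟨$⟩ʳ suc i ≡ punchIn s (σ ⟨$⟩ʳ i)
  at-suc i = Perm.insert-punchIn zero s σ i
  ordered′ : ∀ i j → (Perm.insert zero s σ ⟨$⟩ʳ i) ⟶ (Perm.insert zero s σ ⟨$⟩ʳ j) → i Fin.< j
  ordered′ i       zero    e = contradiction e (source _)
  ordered′ zero    (suc j) e = z<s
  ordered′ (suc i) (suc j) e = s<s (ordered i j (subst₂ _⟶_ (at-suc i) (at-suc j) e))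

flip-cycle : ∀ {A : Set} {_⟶_ : Rel A 0ℓ} {u v} → TransClosure (flip _⟶_) u v → TransClosure _⟶_ v u
flip-cycle [ e ]   = [ e ]
flip-cycle (e ∷ p) = flip-cycle p TC.++ [ e ]

-- The inverse of `σ` turns vertices into positions. Injectivity holds because `y` is increasing,
-- and no edge is missed because every edge goes up in the order.
unlabel : ∀ {n N} {adj : Fin n → Fin n → Bool} {S : Rel (Fin N) 0ℓ} (σ : Permutation n n) →
  (∀ i j → T (adj (σ ⟨$⟩ʳ i) (σ ⟨$⟩ʳ j)) → i Fin.< j) →
  OrderedCopy Fin._<_ S (λ i j → adj (σ ⟨$⟩ʳ i) (σ ⟨$⟩ʳ j)) →
  Σ[ f ∈ (Fin n → Fin N) ] Injective _≡_ _≡_ f × (∀ u v → T (adj u v) → S (f u) (f v))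
unlabel {adj = adj} {S} σ ordered (y , copy) = y ∘ (σ ⟨$⟩ˡ_) , injective , edges
  where
  y-injective : ∀ i j → y i ≡ y j → i ≡ j
  y-injective i j eq with <-cmp i j
  ... | tri< i<j _ _  = contradiction eq (<⇒≢ (proj₁ (copy i j i<j)))
  ... | tri≈ _ i≡j _  = i≡j
  ... | tri> _ _ j<i  = contradiction (sym eq) (<⇒≢ (proj₁ (copy j i j<i)))
  injective : Injective _≡_ _≡_ (y ∘ (σ ⟨$⟩ˡ_))
  injective {u} {v} eq = trans (sym (inverseʳ σ)) (trans (cong (σ ⟨$⟩ʳ_) (y-injective _ _ eq)) (inverseʳ σ))
  edges : ∀ u v → T (adj u v) → S (y (σ ⟨$⟩ˡ u)) (y (σ ⟨$⟩ˡ v))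
  edges u v e = proj₂ (copy _ _ (ordered _ _ e′)) e′
    where
    e′ : T (adj (σ ⟨$⟩ʳ (σ ⟨$⟩ˡ u)) (σ ⟨$⟩ʳ (σ ⟨$⟩ˡ v)))
    e′ = subst₂ (λ a b → T (adj a b)) (sym (inverseʳ σ)) (sym (inverseʳ σ)) e

-- From coloured tournaments to ordered copies.

module _ {N k} (𝕋 : Tournament N) (c : EdgeColouring k 𝕋) where

  open Tournament 𝕋

  Coloured : Fin k → Rel (Fin N) 0ℓ
  Coloured i u v = Σ[ e ∈ u ⟶ v ] c u v e ≡ i

  coloured? : ∀ i → Decidable₂ (Coloured i)
  coloured? i u v with T? (adj u v)
  ... | no ¬e = no (¬e ∘ proj₁)
  -- The colour takes the edge proof as an argument; such proofs are unique, so testing one decides.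
  ... | yes e = map′ (e ,_) (λ (e′ , eq) → trans (cong (c u v) (T-irrelevant e e′)) eq) (c u v e ≟ i)

  Directed : Fin 2 × Fin k → Rel (Fin N) 0ℓ
  Directed (zero     , i) = Coloured i
  Directed (suc zero , i) = flip (Coloured i)

  directed? : ∀ d → Decidable₂ (Directed d)
  directed? (zero     , i)     = coloured? i
  directed? (suc zero , i) u v = coloured? i v u

  directed-total : ∀ {u v} → u Fin.< v → ∃[ d ] Directed (remQuot {2} k d) u v
  directed-total {u} {v} u<v with total u v (<⇒≢ u<v)
  ... | inj₁ e = combine {2} zero (c u v e) ,
        subst (λ d → Directed d u v) (sym (remQuot-combine {2} zero (c u v e))) (e , refl)
  ... | inj₂ e = combine {2} (suc zero) (c v u e) ,
        subst (λ d → Directed d u v) (sym (remQuot-combine {2} (suc zero) (c v u e))) (e , refl)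

module _ {n} (H : Digraph n) (acyclic : Digraph.Acyclic H) where

  open Digraph H

  out-deg≤ : ∀ v → ∥ adj v ∥ ≤ maxDegree
  out-deg≤ v = ≤-trans (m≤m+n _ _) (≤-foldr-⊔ degree v)

  in-deg≤ : ∀ v → ∥ (λ u → adj u v) ∥ ≤ maxDegree
  in-deg≤ v = ≤-trans (m≤n+m _ _) (≤-foldr-⊔ degree v)

  forward : Σ[ σ ∈ Permutation n n ] (∀ i j → (σ ⟨$⟩ʳ i) ⟶ (σ ⟨$⟩ʳ j) → i Fin.< j)
  forward = topological-order (λ u v → T? (adj u v)) acyclic

  backward : Σ[ σ ∈ Permutation n n ] (∀ i j → (σ ⟨$⟩ʳ j) ⟶ (σ ⟨$⟩ʳ i) → i Fin.< j)
  backward = topological-order (λ u v → T? (adj v u)) (λ v → acyclic v ∘ flip-cycle)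

  -- Tournament edges of a backward colour run from the later vertex to the earlier one, hence the
  -- exchange of `i` and `j` in the second clause.
  orderedGraph : Fin 2 → Fin n → Fin n → Bool
  orderedGraph zero       i j = adj (proj₁ forward ⟨$⟩ʳ i) (proj₁ forward ⟨$⟩ʳ j)
  orderedGraph (suc zero) i j = adj (proj₁ backward ⟨$⟩ʳ j) (proj₁ backward ⟨$⟩ʳ i)

  out-deg : ∀ d i → ∥ orderedGraph d i ∥ ≤ maxDegree
  out-deg zero       i = ≤-trans (≤-reflexive (∥∥-permute _ (proj₁ forward)))  (out-deg≤ _)
  out-deg (suc zero) i = ≤-trans (≤-reflexive (∥∥-permute _ (proj₁ backward))) (in-deg≤ _)

  in-deg : ∀ d j → ∥ (λ i → orderedGraph d i j) ∥ ≤ maxDegree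
  in-deg zero       j = ≤-trans (≤-reflexive (∥∥-permute _ (proj₁ forward)))  (in-deg≤ _)
  in-deg (suc zero) j = ≤-trans (≤-reflexive (∥∥-permute _ (proj₁ backward))) (out-deg≤ _)

  unavoidable : ∀ k .{{_ : NonZero k}} p → n ≤ 2 ^ p → Unavoidable k H (2 ^ height maxDegree p (2 * k ∸ 1))
  -- Matching on `suc` lets `suc (2 * k ∸ 1)` compute to `2 * k`, the number of directed colours.
  unavoidable k@(suc _) p n≤2^p 𝕋 c =
    let d , copy = ordered-ramsey (2 * k ∸ 1)
          (λ d → Directed 𝕋 c (remQuot k d)) (λ d → directed? 𝕋 c (remQuot k d))
          (λ d → orderedGraph (proj₁ (remQuot {2} k d))) p maxDegree n≤2^p
          (λ d → out-deg (proj₁ (remQuot {2} k d))) (λ d → in-deg (proj₁ (remQuot {2} k d)))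
          Fin._<_ (directed-total 𝕋 c) (allFin N) (AllPairs.tabulate⁺-< id)
          (≤-reflexive (sym (length-tabulate {n = N} id)))
    in monochromatic (remQuot {2} k d) copy
    where
    N = 2 ^ height maxDegree p (2 * k ∸ 1)
    monochromatic : ∀ d → OrderedCopy Fin._<_ (Directed 𝕋 c d) (orderedGraph (proj₁ d)) → MonochromaticCopy H 𝕋 c
    monochromatic (zero , i) copy = i , unlabel {S = Coloured 𝕋 c i} (proj₁ forward) (proj₂ forward) copy
    monochromatic (suc zero , i) copy =
      let f , injective , edges =
            unlabel {adj = flip adj} {S = flip (Coloured 𝕋 c i)} (proj₁ backward) (proj₂ backward) copy
      in i , f , injective , λ u v → edges v u

-- Decidability of unavoidability and the least such number.

isEdge : ∀ {k} → Fin (suc k) → Bool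
isEdge zero    = false
isEdge (suc _) = true

label : ∀ {k} (a : Fin (suc k)) → T (isEdge a) → Fin k
label (suc i) _ = i

suc-label : ∀ {k} (a : Fin (suc k)) e → suc (label a e) ≡ a
suc-label (suc i) _ = refl

-- A k-coloured tournament is encoded as a matrix in which zero marks a missing edge and suc i an
-- edge of colour i; such matrices range over a finite type.
Matrix : ℕ → ℕ → Set
Matrix k N = Fin N → Fin N → Fin (suc k)

decode : ∀ {k N} → Fin (suc k ^ (N * N)) → Matrix k N
decode code u v = finToFun code (combine u v)

encode : ∀ {k N} → Matrix k N → Fin (suc k ^ (N * N))
encode {N = N} M = funToFin (uncurry M ∘ remQuot {N} N)

decode-encode : ∀ {k N} (M : Matrix k N) u v → decode {k} (encode M) u v ≡ M u v
decode-encode {N = N} M u v =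
  trans (finToFun-funToFin (uncurry M ∘ remQuot {N} N) (combine u v))
        (cong (uncurry M) (remQuot-combine {N} u v))

IsTournament : ∀ {k N} → Matrix k N → Set
IsTournament M = (∀ u v → T (isEdge (M u v)) → ¬ T (isEdge (M v u))) ×
                 (∀ u v → u ≢ v → T (isEdge (M u v)) ⊎ T (isEdge (M v u)))

isTournament? : ∀ {k N} → Decidable (IsTournament {k} {N})
isTournament? M =
  all? (λ u → all? λ v → T? (isEdge (M u v)) →-dec ¬? (T? (isEdge (M v u)))) ×-dec
  all? (λ u → all? λ v → ¬? (u ≟ v) →-dec (T? (isEdge (M u v)) ⊎-dec T? (isEdge (M v u))))

module _ {n} (H : Digraph n) where

  open Digraph H

  -- Maps enter through codes in `Fin (N ^ n)`, which makes the search for a copy finite.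
  MatrixCopy : ∀ {k N} → Matrix k N → Set
  MatrixCopy {k} {N} M = Σ[ i ∈ Fin k ] Σ[ code ∈ Fin (N ^ n) ]
    let f = finToFun code in
    (∀ u v → f u ≡ f v → u ≡ v) × (∀ u v → u ⟶ v → M (f u) (f v) ≡ suc i)

  matrixCopy? : ∀ {k N} → Decidable (MatrixCopy {k} {N})
  matrixCopy? M = any? λ i → any? λ code →
    all? (λ u → all? λ v → (finToFun code u ≟ finToFun code v) →-dec (u ≟ v)) ×-dec
    all? (λ u → all? λ v → T? (adj u v) →-dec (M (finToFun code u) (finToFun code v) ≟ suc i))

  module _ {k N : ℕ} where

    unavoidable⇒matrixCopy : Unavoidable k H N → (M : Matrix k N) → IsTournament M → MatrixCopy M
    unavoidable⇒matrixCopy unav M (asym′ , total′) =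
      let i , f , injective , edges = unav 𝕋 (λ u v → label (M u v))
          f≗ = finToFun-funToFin f
      in i , funToFin f ,
         (λ u v eq → injective (trans (sym (f≗ u)) (trans eq (f≗ v)))) ,
         (λ u v e → let e′ , eq = edges u v e in
            trans (cong₂ M (f≗ u) (f≗ v)) (trans (sym (suc-label _ e′)) (cong suc eq)))
      where
      𝕋 : Tournament N
      𝕋 = record
        { digraph = record { adj = λ u v → isEdge (M u v) ; asym = asym′ }
        ; total   = total′
        }

    matrixCopy⇒unavoidable :
      (∀ code → IsTournament (decode {k} {N} code) → MatrixCopy (decode {k} {N} code)) → Unavoidable k H N
    matrixCopy⇒unavoidable copies 𝕋 c =
      let i , code , injective , edges = copies (encode M)
            ( (λ u v e e′ → 𝕋.asym u v (isEdge⇒⟶ e) (isEdge⇒⟶ e′))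
            , (λ u v u≢v → Sum.map ⟶⇒isEdge ⟶⇒isEdge (𝕋.total u v u≢v)) )
      in i , finToFun code , injective _ _ , λ u v e →
         entry⇒coloured (trans (sym (decode-encode M _ _)) (edges u v e))
      where
      module 𝕋 = Tournament 𝕋
      M : Matrix k N
      M u v with T? (𝕋.adj u v)
      ... | yes e = suc (c u v e)
      ... | no  _ = zero
      entry⇒coloured : ∀ {u v i} → M u v ≡ suc i → Coloured 𝕋 c i u v
      entry⇒coloured {u} {v} eq with T? (𝕋.adj u v) | eq
      ... | yes e | refl = e , refl
      ... | no _  | ()
      isEdge⇒⟶ : ∀ {u v} → T (isEdge (decode {k} (encode M) u v)) → u 𝕋.⟶ v
      isEdge⇒⟶ {u} {v} e rewrite decode-encode M u v with T? (𝕋.adj u v)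
      ... | yes e′ = e′
      ⟶⇒isEdge : ∀ {u v} → u 𝕋.⟶ v → T (isEdge (decode {k} (encode M) u v))
      ⟶⇒isEdge {u} {v} e rewrite decode-encode M u v with T? (𝕋.adj u v)
      ... | yes _ = _
      ... | no ¬e = ¬e e

  -- The exact Ramsey number comes from a minimum search, which needs this decision; codes leave
  -- finitely many tournaments to check.
  unavoidable? : ∀ k N → Dec (Unavoidable k H N)
  unavoidable? k N = map′ matrixCopy⇒unavoidable (λ unav → unavoidable⇒matrixCopy unav ∘ decode)
    (all? λ code → isTournament? (decode {k} {N} code) →-dec matrixCopy? (decode code))

least : {P : Pred ℕ 0ℓ} → Decidable P → ∀ n → P n → ∃[ r ] r ≤ n × P r × (∀ m → P m → r ≤ m)
least {P} P? = <-rec _ step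
  where
  step : ∀ n → (∀ {m} → m < n → P m → ∃[ r ] r ≤ m × P r × (∀ m → P m → r ≤ m)) → P n →
         ∃[ r ] r ≤ n × P r × (∀ m → P m → r ≤ m)
  step n rec Pn with anyUpTo? P? n
  ... | no none = n , ≤-refl , Pn , λ m Pm → ≮⇒≥ (λ m<n → none (m , m<n , Pm))
  ... | yes (m , m<n , Pm) with r , r≤m , r-least ← rec m<n Pm = r , ≤-trans r≤m (<⇒≤ m<n) , r-least

-- Logarithms and the final bound.

floor-log : ∀ n → 1 ≤ n → ∃[ L ] 2 ^ L ≤ n × n < 2 ^ suc L
floor-log (suc zero)    _ = 0 , ≤-refl , ≤-refl
floor-log (suc n@(suc _)) _ with L , lower , upper ← floor-log n (s≤s z≤n) | suc n <? 2 ^ suc L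
... | yes 1+n< = L , m≤n⇒m≤1+n lower , 1+n<
... | no  1+n≮ = suc L , ≮⇒≥ 1+n≮ , ≤-trans (s≤s upper) (≤-trans (+-monoˡ-≤ (2 ^ suc L) (m^n>0 2 (suc L)))
                   (≤-reflexive (double (2 ^ suc L))))

-- L is the floor of log₂ n.  The factor 2 absorbs the rounding for n ≥ 2, and for n ≤ 1 nothing is rounded.
log-bound : ∀ n → ∃[ L ] n ≤ 2 ^ (2 * L) × (∀ a b → log₂ n ≤ a ÷ b → L * b ≤ a)
log-bound zero = 0 , z≤n , λ _ _ _ → z≤n
log-bound n@(suc _) with floor-log n (s≤s z≤n)
... | zero  , _     , n<2 = 0 , s≤s⁻¹ n<2 , λ _ _ _ → z≤n
... | L@(suc L-1) , 2^L≤n , n<2^ = L , ≤-trans (<⇒≤ n<2^) (^-monoʳ-≤ 2 1+L≤2L) , λ a b n^b≤2^a →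
    ≮⇒≥ λ a<Lb → <⇒≱ (^-monoʳ-< 2 (s≤s (s≤s z≤n)) a<Lb)
      (≤-trans (≤-reflexive (sym (^-*-assoc 2 L b))) (≤-trans (^-monoˡ-≤ b 2^L≤n) n^b≤2^a))
  where
  1+L≤2L : suc L ≤ 2 * L
  1+L≤2L = ≤-trans (+-monoˡ-≤ L (s≤s {n = L-1} z≤n)) (≤-reflexive (double L))

^-distribʳ-* : ∀ m n e → (m * n) ^ e ≡ m ^ e * n ^ e
^-distribʳ-* m n zero    = refl
^-distribʳ-* m n (suc e) = trans (cong (m * n *_) (^-distribʳ-* m n e))
  ([m*n]*[o*p]≡[m*o]*[n*p] m n (m ^ e) (n ^ e))

theorem1p7 : ∀ (k Δ : ℕ) → 1 ≤ k →
    ∃[ C ] (∀ (n : ℕ) (H : Digraph n) →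
    Digraph.Acyclic H →
    Digraph.maxDegree H ≡ Δ →
    ∃[ r ] (IsRamseyNumber k H r × (r ≤2^[ C *⟨log₂ n ⟩^ 2 ^ (2 * k ∸ 1) ])))
-- The 2 comes from the choice `p = 2 * L`, and the power `e` from the repeated squaring in
-- `height`.
theorem1p7 k Δ 1≤k = (scale Δ * 2) ^ e , bounded
  where
  e = 2 ^ (2 * k ∸ 1)
  bounded : ∀ n (H : Digraph n) → Digraph.Acyclic H → Digraph.maxDegree H ≡ Δ →
    ∃[ r ] (IsRamseyNumber k H r × (r ≤2^[ (scale Δ * 2) ^ e *⟨log₂ n ⟩^ e ]))
  bounded n H acyclic refl
    with L , n≤ , L-below-log ← log-bound n
    with r , r≤ , minimal ← least (unavoidable? H k) _ (unavoidable H acyclic k {{>-nonZero 1≤k}} (2 * L) n≤)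
    = r , minimal , bound
    where
    open ≤-Reasoning
    s = scale Δ
    h = height Δ (2 * L) (2 * k ∸ 1)
    exponents : ∀ a b → L * b ≤ a → h * b ^ e ≤ (s * 2) ^ e * a ^ e
    exponents a b Lb≤a = begin
      -- The extra factor `s` turns the height into a perfect `e`-th power.
      h * b ^ e                      ≤⟨ *-monoˡ-≤ (b ^ e) (m≤n*m h s) ⟩
      s * h * b ^ e                  ≡⟨ cong (_* b ^ e) (scale*height Δ (2 * L) (2 * k ∸ 1)) ⟩
      (s * (2 * L)) ^ e * b ^ e      ≡⟨ ^-distribʳ-* (s * (2 * L)) b e ⟨
      (s * (2 * L) * b) ^ e          ≡⟨ cong (_^ e) (rearrange s L b) ⟩
      (s * 2 * (L * b)) ^ e          ≤⟨ ^-monoˡ-≤ e (*-monoʳ-≤ (s * 2) Lb≤a) ⟩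
      (s * 2 * a) ^ e                ≡⟨ ^-distribʳ-* (s * 2) a e ⟩
      (s * 2) ^ e * a ^ e            ∎
      where
      rearrange : ∀ s L b → s * (2 * L) * b ≡ s * 2 * (L * b)
      rearrange = solve-∀
    bound : r ≤2^[ (s * 2) ^ e *⟨log₂ n ⟩^ e ]
    bound a b _ n^b≤2^a = begin
      r ^ (b ^ e)                    ≤⟨ ^-monoˡ-≤ (b ^ e) r≤ ⟩
      (2 ^ h) ^ (b ^ e)              ≡⟨ ^-*-assoc 2 h (b ^ e) ⟩
      2 ^ (h * b ^ e)                ≤⟨ ^-monoʳ-≤ 2 (exponents a b (L-below-log a b n^b≤2^a)) ⟩
      2 ^ ((s * 2) ^ e * a ^ e)      ∎
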